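{- We have $$f_{0001}(x)=\frac{1-5x+8x^2-10x^4+5x^5+x^6+x^8}{(1-x)^3(1-x-x^2)^3}$$ as formal power series in $x$, where $f_{0001}(x)=\sum_{n\ge 0} b_n(0001)x^n$ and $b_n(0001)$ is the number of ascent sequences of length $n$ that avoid both patterns $021$ and $0001$.
   Context: For a finite sequence $w=w_1\cdots w_n$ of integers, $\mathrm{asc}(w)$ is the number of indices $1\le i\le n-1$ with $w_i<w_{i+1}$. An ascent sequence of length $n\ge 1$ is a sequence $a_1\cdots a_n$ of non-negative integers such that $a_1=0$ and $a_i\le \mathrm{asc}(a_1\cdots a_{i-1})+1$ for $1<i\le n$; there is exactly one (empty) ascent sequence of length $0$. A sequence $\pi=\pi_1\cdots\pi_n$ contains a pattern $\tau=\tau_1\cdots\tau_m$ if there are indices $1\le i_1<\cdots<i_m\le n$ such that for all $j,k\in\{1,\dots,m\}$: $\pi_{i_j}<\pi_{i_k}$ iff $\tau_j<\tau_k$, and $\pi_{i_j}=\pi_{i_k}$ iff $\tau_j=\tau_k$; otherwise $\pi$ avoids $\tau$. For a pattern $\tau$, $B_n(\tau)$ is the set of ascent sequences of length $n$ avoiding both $021$ and $\tau$ (with $B_0(\tau)$ consisting of the empty sequence), and $b_n(\tau)=|B_n(\tau)|$. -}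

module Defs where

open import Data.Bool.Base using (true; false; if_then_else_)
open import Data.Fin.Base as Fin using (Fin; toℕ)
import Data.Fin.Properties as Fin
open import Data.Integer.Base as ℤ using (ℤ; +_; 0ℤ; 1ℤ)
import Data.Integer.Properties as ℤ
open import Data.List.Base using
  (List; []; _∷_; length; lookup; take; filter; upTo; cartesianProductWith)
open import Data.List.Membership.Propositional using (_∈_)
open import Data.List.Membership.Propositional.Properties using
  (∈-cartesianProductWith⁺; ∈-cartesianProductWith⁻; ∈-filter⁺; ∈-filter⁻; ∈-upTo⁺)
open import Data.List.Properties using (∷-injective; length-take)
open import Data.List.Relation.Unary.All using (All; []; _∷_)
open import Data.List.Relation.Unary.Any using (here; there)
open import Data.List.Relation.Unary.AllPairs using ([]; _∷_)
open import Data.List.Relation.Unary.Unique.Propositional using (Unique)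
import Data.List.Relation.Unary.Unique.Propositional.Properties as Unique
open import Data.Nat.Base as ℕ using (ℕ; zero; suc; _∸_; _≤_; _<_; z≤n; s≤s)
import Data.Nat.Properties as ℕ
open import Data.Product.Base using (∃; _×_; _,_; proj₂)
open import Data.Unit.Base using (⊤; tt)
open import Data.Vec.Base as Vec using (Vec; []; _∷_)
open import Function.Bundles using (_⇔_; mk⇔; Equivalence)
open import Relation.Binary.PropositionalEquality using
  (_≡_; _≗_; refl; cong; module ≡-Reasoning)
open import Relation.Nullary.Decidable using
  (Dec; yes; no; does; True; toWitness; map′; _×-dec_; _→-dec_; ¬?)
open import Relation.Nullary.Negation using (¬_)
open import Relation.Unary using (Decidable)

------------------------------------------------------------------------
-- Ascent sequences

asc : List ℕ → ℕ
asc []          = 0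
asc (_ ∷ [])    = 0
asc (x ∷ y ∷ w) = (if does (x ℕ.<? y) then 1 else 0) ℕ.+ asc (y ∷ w)

-- Positions are 0-based: lookup w i is the (i + 2)-nd term of a ∷ w, and
-- take (suc (toℕ i)) (a ∷ w) is everything strictly before it.

IsAscentSequence : List ℕ → Set
IsAscentSequence []      = ⊤
IsAscentSequence (a ∷ w) =
  a ≡ 0 ×
  (∀ (i : Fin (length w)) →
     lookup w i ≤ asc (take (suc (toℕ i)) (a ∷ w)) ℕ.+ 1)

------------------------------------------------------------------------
-- Pattern containment

-- The Vec ι lists the chosen positions i₁ < ⋯ < iₘ.

IsOccurrence : (π τ : List ℕ) → Vec (Fin (length π)) (length τ) → Set
IsOccurrence π τ ι =
  (∀ j k → j Fin.< k → Vec.lookup ι j Fin.< Vec.lookup ι k) ×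
  (∀ j k →
     (lookup π (Vec.lookup ι j) < lookup π (Vec.lookup ι k)
        ⇔ lookup τ j < lookup τ k) ×
     (lookup π (Vec.lookup ι j) ≡ lookup π (Vec.lookup ι k)
        ⇔ lookup τ j ≡ lookup τ k))

Contains : (π τ : List ℕ) → Set
Contains π τ = ∃ (IsOccurrence π τ)

Avoids : (π τ : List ℕ) → Set
Avoids π τ = ¬ Contains π τ

------------------------------------------------------------------------
-- The sets B_n(τ) and their cardinalities

InB : (τ : List ℕ) (n : ℕ) → List ℕ → Set
InB τ n w =
  length w ≡ n ×
  IsAscentSequence w × Avoids w (0 ∷ 2 ∷ 1 ∷ []) × Avoids w τ

isAscentSequence? : Decidable IsAscentSequence
isAscentSequence? []      = yes tt
isAscentSequence? (a ∷ w) =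
  (a ℕ.≟ 0) ×-dec Fin.all? (λ _ → _ ℕ.≤? _)

_⇔-dec_ : ∀ {A B : Set} → Dec A → Dec B → Dec (A ⇔ B)
a? ⇔-dec b? =
  map′ (λ (f , g) → mk⇔ f g) (λ e → Equivalence.to e , Equivalence.from e)
       ((a? →-dec b?) ×-dec (b? →-dec a?))

anyVec? : ∀ {n} m {P : Vec (Fin n) m → Set} → Decidable P → Dec (∃ P)
anyVec? zero    P? = map′ (λ p → [] , p) (λ { ([] , p) → p }) (P? [])
anyVec? (suc m) P? =
  map′ (λ { (i , ι , p) → i ∷ ι , p }) (λ { (i ∷ ι , p) → i , ι , p })
       (Fin.any? (λ i → anyVec? m (λ ι → P? (i ∷ ι))))

contains? : ∀ π τ → Dec (Contains π τ)
contains? π τ = anyVec? (length τ) λ ι →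
  Fin.all? (λ j → Fin.all? (λ k →
    (j Fin.<? k) →-dec (Vec.lookup ι j Fin.<? Vec.lookup ι k)))
  ×-dec
  Fin.all? (λ j → Fin.all? (λ k →
    ((_ ℕ.<? _) ⇔-dec (_ ℕ.<? _)) ×-dec ((_ ℕ.≟ _) ⇔-dec (_ ℕ.≟ _))))

inB? : ∀ τ n → Decidable (InB τ n)
inB? τ n w =
  (length w ℕ.≟ n) ×-dec isAscentSequence? w ×-dec
  ¬? (contains? w _) ×-dec ¬? (contains? w τ)

-- All words of length n over the alphabet {0, …, k - 1}.

words : (k n : ℕ) → List (List ℕ)
words k zero    = [] ∷ []
words k (suc n) = cartesianProductWith _∷_ (upTo k) (words k n)

-- An ascent sequence of length n has all entries below n, so filtering
-- words n n misses nothing; see B-unique and ∈-B.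

B : (τ : List ℕ) (n : ℕ) → List (List ℕ)
B τ n = filter (inB? τ n) (words n n)

b : (τ : List ℕ) (n : ℕ) → ℕ
b τ n = length (B τ n)

words-unique : ∀ k n → Unique (words k n)
words-unique k zero    = [] ∷ []
words-unique k (suc n) =
  Unique.cartesianProductWith⁺ _∷_ ∷-injective
    (Unique.upTo⁺ k) (words-unique k n)

∈-words : ∀ {k} w → All (_< k) w → w ∈ words k (length w)
∈-words []      []         = here refl
∈-words (x ∷ w) (x<k ∷ w<k) =
  ∈-cartesianProductWith⁺ _∷_ (∈-upTo⁺ x<k) (∈-words w w<k)

asc<length : ∀ x w → asc (x ∷ w) < length (x ∷ w)
asc<length x []      = s≤s z≤n
asc<length x (y ∷ w) with does (x ℕ.<? y)
... | true  = s≤s (asc<length y w)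
... | false = ℕ.m<n⇒m<1+n (asc<length y w)

all-lookup : ∀ {P : ℕ → Set} w → (∀ i → P (lookup w i)) → All P w
all-lookup []      h = []
all-lookup (x ∷ w) h = h Fin.zero ∷ all-lookup w (λ i → h (Fin.suc i))

ascentSequence-bounded : ∀ w → IsAscentSequence w → All (_< length w) w
ascentSequence-bounded []      _          = []
ascentSequence-bounded (a ∷ w) (refl , h) =
  s≤s z≤n ∷ all-lookup w (λ i → s≤s (bound i))
  where
  bound : ∀ i → lookup w i ≤ length w
  bound i = begin
    lookup w i                           ≤⟨ h i ⟩
    asc (0 ∷ take (toℕ i) w) ℕ.+ 1       ≡⟨ ℕ.+-comm _ 1 ⟩
    suc (asc (0 ∷ take (toℕ i) w))       ≤⟨ asc<length 0 (take (toℕ i) w) ⟩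
    suc (length (take (toℕ i) w))        ≡⟨ cong suc (length-take (toℕ i) w) ⟩
    suc (toℕ i ℕ.⊓ length w)             ≤⟨ s≤s (ℕ.m⊓n≤m (toℕ i) (length w)) ⟩
    suc (toℕ i)                          ≤⟨ Fin.toℕ<n i ⟩
    length w                             ∎
    where open ℕ.≤-Reasoning

B-unique : ∀ τ n → Unique (B τ n)
B-unique τ n = Unique.filter⁺ (inB? τ n) (words-unique n n)

∈-B : ∀ τ n w → w ∈ B τ n ⇔ InB τ n w
∈-B τ n w = mk⇔ sound complete
  where
  sound : w ∈ B τ n → InB τ n w
  sound w∈B = proj₂ (∈-filter⁻ (inB? τ n) {xs = words n n} w∈B)

  ∈-words′ : InB τ n w → w ∈ words n n
  ∈-words′ (refl , asc-w , _) = ∈-words w (ascentSequence-bounded w asc-w)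

  complete : InB τ n w → w ∈ B τ n
  complete p = ∈-filter⁺ (inB? τ n) (∈-words′ p) p

------------------------------------------------------------------------
-- Formal power series with integer coefficients

-- A series is its coefficient sequence; equality of series is _≗_.

Series : Set
Series = ℕ → ℤ

infixl 6 _+_ _-_
infixl 7 _*_ _/_
infixr 8 _·_
infixr 9 _^_

𝟙 X : Series
𝟙 zero    = 1ℤ
𝟙 (suc _) = 0ℤ
X zero          = 0ℤ
X (suc zero)    = 1ℤ
X (suc (suc _)) = 0ℤ

_+_ _-_ _*_ : Series → Series → Series
(p + q) n = p n ℤ.+ q n
(p - q) n = p n ℤ.- q n
(p * q) n = ∑[ i ≤ n ] (p (toℕ i) ℤ.* q (n ∸ toℕ i))
  where open import Algebra.Properties.Monoid.Sum ℤ.+-0-monoid using (sum⁺-syntax)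

_·_ : ℕ → Series → Series
(c · p) n = + c ℤ.* p n

_^_ : Series → ℕ → Series
p ^ zero  = 𝟙
p ^ suc k = p * p ^ k

-- Long division by a series with constant term 1 (hence a unit); the
-- implicit argument is inferred for any concrete such denominator.
-- By /-* the result is indeed the quotient.

_/_ : (p q : Series) → {True (q 0 ℤ.≟ 1ℤ)} → Series
(p / q) zero        = p 0
(_/_ p q {u}) (suc n) =
  _/_ (λ k → p (suc k) ℤ.- p 0 ℤ.* q (suc k)) q {u} n

/-* : ∀ p q {u : True (q 0 ℤ.≟ 1ℤ)} → _/_ p q {u} * q ≗ p
/-* p q {u} zero = begin
  p 0 ℤ.* q 0 ℤ.+ 0ℤ  ≡⟨ ℤ.+-identityʳ _ ⟩
  p 0 ℤ.* q 0         ≡⟨ cong (p 0 ℤ.*_) (toWitness u) ⟩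
  p 0 ℤ.* 1ℤ          ≡⟨ ℤ.*-identityʳ _ ⟩
  p 0                 ∎
  where open ≡-Reasoning
/-* p q {u} (suc n) = begin
  c ℤ.+ (_/_ p′ q {u} * q) n      ≡⟨ cong (λ z → c ℤ.+ z) (/-* p′ q {u} n) ⟩
  c ℤ.+ (p (suc n) ℤ.- c)         ≡⟨ ℤ.+-comm c _ ⟩
  p (suc n) ℤ.- c ℤ.+ c           ≡⟨ ℤ.+-assoc (p (suc n)) (ℤ.- c) c ⟩
  p (suc n) ℤ.+ (ℤ.- c ℤ.+ c)     ≡⟨ cong (λ z → p (suc n) ℤ.+ z) (ℤ.+-inverseˡ c) ⟩
  p (suc n) ℤ.+ 0ℤ                ≡⟨ ℤ.+-identityʳ _ ⟩
  p (suc n)                       ∎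
  where
  open ≡-Reasoning
  c : ℤ
  c = p 0 ℤ.* q (suc n)
  p′ : Series
  p′ k = p (suc k) ℤ.- p 0 ℤ.* q (suc k)

f : (τ : List ℕ) → Series
f τ n = + b τ n

{-# OPTIONS --safe #-}
module Submission where

-- Avoiding 021 means that the nonzero letters weakly increase.  Reading an ascent
-- sequence from left to right, avoidance of 0001 then depends on the prefix only
-- through the numbers of zeros and of copies of the maximum (each capped at 3),
-- and the bound on the next letter through the excess of the number of ascents
-- over the maximum.  So the sequences are the paths of an automaton with finitely
-- many reachable states.  The product of the denominator with the generating
-- function of any state is checked to have vanishing coefficient at x⁹, and the
-- transitions propagate this to all higher coefficients; the lower ones are
-- computed.

open import Defs
open import Data.Bool.Base using (Bool; true; false; if_then_else_)
import Data.Bool.Properties as Bool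
open import Data.Fin.Base as Fin using (Fin; zero; suc; toℕ)
open import Data.Fin.Patterns using (0F; 1F; 2F; 3F)
open import Data.Integer.Base as ℤ using (ℤ; +_; 0ℤ; 1ℤ; -1ℤ)
import Data.Integer.Properties as ℤ
open import Data.Integer.Tactic.RingSolver using (solve-∀)
open import Data.List.Base as List using
  (List; []; _∷_; _++_; length; lookup; map; concatMap; upTo; drop)
open import Data.List.Membership.Propositional using (_∈_; find; lose)
open import Data.List.Membership.Propositional.Properties using
  (∈-map⁺; ∈-map⁻; ∈-upTo⁺; ∈-upTo⁻; ∈-concatMap⁺; ∈-concatMap⁻; ∈-lookup)
open import Data.List.Membership.Propositional.Properties.WithK using (unique∧set⇒bag)
open import Data.List.Properties using
  (∷-injectiveˡ; ∷-injectiveʳ; length-++; length-map; map-cong; map-∘; tabulate-lookup)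
open import Data.List.Relation.Binary.BagAndSetEquality using (∼bag⇒↭)
open import Data.List.Relation.Binary.Disjoint.Propositional using (Disjoint)
open import Data.List.Relation.Binary.Permutation.Propositional.Properties using (↭-length)
open import Data.List.Relation.Unary.All as All using (All; []; _∷_)
import Data.List.Relation.Unary.All.Properties as All
open import Data.List.Relation.Unary.AllPairs as AllPairs using (AllPairs; []; _∷_)
import Data.List.Relation.Unary.AllPairs.Properties as AllPairs
open import Data.List.Relation.Unary.Any using (here; there)
open import Data.List.Relation.Unary.Unique.Propositional using (Unique)
import Data.List.Relation.Unary.Unique.Propositional.Properties as Unique
open import Data.Nat.Base as ℕ using (ℕ; zero; suc; pred; _∸_; _≤_; _<_; z≤n; s≤s)
open import Data.Nat.ListAction using (sum)
import Data.Nat.Properties as ℕ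
import Data.Nat.Tactic.RingSolver as ℕSolver
open import Data.Product.Base using (∃; ∃₂; _×_; _,_; proj₁; proj₂)
open import Data.Sum.Base using (_⊎_; inj₁; inj₂)
open import Data.Unit.Base using (tt)
open import Data.Vec.Base as Vec using (Vec; []; _∷_)
import Data.Vec.Properties as Vec
open import Data.Vec.Relation.Unary.Linked as Linked using (Linked; []; [-]; _∷_)
import Data.Vec.Relation.Unary.Linked.Properties as Linked
open import Function.Base using (_∘_)
open import Function.Bundles using (_⇔_; mk⇔; Equivalence)
open import Relation.Binary.Definitions using (DecidableEquality; tri<; tri≈; tri>)
open import Relation.Binary.PropositionalEquality using
  (_≡_; _≢_; _≗_; refl; sym; trans; cong; cong₂; subst; subst₂; module ≡-Reasoning)
open import Relation.Nullary.Decidable using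
  (yes; no; does; True; toWitness; map′; _×-dec_; dec-true; dec-false)
open import Relation.Nullary.Negation using (¬_; contradiction)

private
  variable
    a d k l m n r s t x y z : ℕ
    u w : List ℕ

-- Pattern occurrences

-- Assigns values to the letters 0, 1, 2, ... of a pattern one at a time; the tail `g` continues the
-- assignment to all of ℕ.
prepend : ℕ → (ℕ → ℕ) → ℕ → ℕ
prepend x g zero    = x
prepend x g (suc t) = g t

StrictlyMonotone : (ℕ → ℕ) → Set
StrictlyMonotone g = ∀ {s t} → s < t → g s < g t

+-strictlyMonotone : ∀ y → StrictlyMonotone (ℕ._+ y)
+-strictlyMonotone y = ℕ.+-monoˡ-< y

prepend-strictlyMonotone : ∀ {g} → x < g 0 → StrictlyMonotone g →
                           StrictlyMonotone (prepend x g)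
prepend-strictlyMonotone x<g0 mono {zero}  {suc zero}    _         = x<g0
prepend-strictlyMonotone x<g0 mono {zero}  {suc (suc t)} _         =
  ℕ.<-trans x<g0 (mono {0} {suc t} (s≤s z≤n))
prepend-strictlyMonotone x<g0 mono {suc s} {suc t}       (s≤s s<t) = mono s<t

-- A strictly monotone `g` reflects `<` and `≡` by trichotomy, so one value equation per position
-- yields all the equivalences of an occurrence.
contains-⁺ : ∀ π τ {g} (ι : Vec (Fin (length π)) (length τ)) →
             StrictlyMonotone g → Linked Fin._<_ ι →
             (∀ j → lookup π (Vec.lookup ι j) ≡ g (lookup τ j)) →
             Contains π τ
contains-⁺ π τ {g} ι mono increasing values =
  ι , (λ j k → Linked.lookup⁺ ℕ.<-trans increasing) , λ j k →
    mk⇔ (λ lt → reflects-< _ _ (subst₂ _<_ (values j) (values k) lt))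
        (λ lt → subst₂ _<_ (sym (values j)) (sym (values k)) (mono lt)) ,
    mk⇔ (λ eq → reflects-≡ _ _ (trans (sym (values j)) (trans eq (values k))))
        (λ eq → trans (values j) (trans (cong g eq) (sym (values k))))
  where
  reflects-< : ∀ s t → g s < g t → s < t
  reflects-< s t lt with ℕ.<-cmp s t
  ... | tri< s<t _ _  = s<t
  ... | tri≈ _ refl _ = contradiction lt (ℕ.<-irrefl refl)
  ... | tri> _ _ t<s  = contradiction (mono t<s) (ℕ.<-asym lt)

  reflects-≡ : ∀ s t → g s ≡ g t → s ≡ t
  reflects-≡ s t eq with ℕ.<-cmp s t
  ... | tri< s<t _ _ = contradiction (mono s<t) (ℕ.<-irrefl eq)
  ... | tri≈ _ s≡t _ = s≡t
  ... | tri> _ _ t<s = contradiction (mono t<s) (ℕ.<-irrefl (sym eq))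

-- The pairs `y` before `x` that do not form 021 with a preceding 0.
_⊴_ : ℕ → ℕ → Set
y ⊴ x = x ≡ 0 ⊎ y ≤ x

allPairs-lookup : ∀ {R : ℕ → ℕ → Set} u → AllPairs R u →
                  ∀ {i j} → i Fin.< j → R (lookup u i) (lookup u j)
allPairs-lookup (x ∷ u) (px ∷ _)  {zero}  {suc j} _         = All.lookup px (∈-lookup j)
allPairs-lookup (x ∷ u) (_ ∷ pxs) {suc i} {suc j} (s≤s i<j) = allPairs-lookup u pxs i<j

-- The leading 0 can always play the 0 of the pattern, so only descents to a positive letter matter.
-- Conversely, the last two positions of an occurrence lie in `u`, and its third letter is positive
-- because it exceeds the first.
avoids021⇔ : ∀ u → Avoids (0 ∷ u) (0 ∷ 2 ∷ 1 ∷ []) ⇔ AllPairs _⊴_ u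
avoids021⇔ u = mk⇔ sorted avoids
  where
  sorted : Avoids (0 ∷ u) (0 ∷ 2 ∷ 1 ∷ []) → AllPairs _⊴_ u
  sorted avoid =
    subst (AllPairs _⊴_) (tabulate-lookup u) (AllPairs.tabulate⁺-< pair)
    where
    pair : ∀ {i j} → i Fin.< j → lookup u i ⊴ lookup u j
    pair {i} {j} i<j with lookup u j ℕ.≟ 0 | lookup u i ℕ.≤? lookup u j
    ... | yes z | _     = inj₁ z
    ... | no _  | yes p = inj₂ p
    ... | no nz | no ¬p = contradiction
      (contains-⁺ (0 ∷ u) (0 ∷ 2 ∷ 1 ∷ []) (zero ∷ suc i ∷ suc j ∷ [])
        -- The pattern letters 0, 1, 2 go to 0, `lookup u j`, `lookup u i`.
        (prepend-strictlyMonotone (ℕ.n≢0⇒n>0 nz)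
          (prepend-strictlyMonotone (ℕ.≰⇒> ¬p) (+-strictlyMonotone (lookup u i))))
        (s≤s z≤n ∷ s≤s i<j ∷ [-])
        λ { 0F → refl ; 1F → refl ; 2F → refl })
      avoid

  avoids : AllPairs _⊴_ u → Avoids (0 ∷ u) (0 ∷ 2 ∷ 1 ∷ [])
  avoids sort (i ∷ zero ∷ k ∷ [] , inc , _) with () ← inc 0F 1F (s≤s z≤n)
  avoids sort (i ∷ suc j ∷ zero ∷ [] , inc , _)
    with () ← inc 1F 2F (s≤s (s≤s z≤n))
  avoids sort (i ∷ suc j ∷ suc k ∷ [] , inc , iso)
    with allPairs-lookup u sort (ℕ.s<s⁻¹ (inc 1F 2F (s≤s (s≤s z≤n))))
  ... | inj₁ z = contradiction z (ℕ.m<n⇒n≢0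
    (Equivalence.from (proj₁ (iso 0F 2F)) (s≤s z≤n)))
  ... | inj₂ p = ℕ.<⇒≱
    (Equivalence.from (proj₁ (iso 2F 1F)) (s≤s (s≤s z≤n))) p

-- A subsequence of `k` copies of `x` and then a larger letter; 0001 is the case `k = 3`. Letting
-- `k` vary allows an occurrence to be consumed while the word is read.
data Rise (x : ℕ) : ℕ → List ℕ → Set where
  last : x < y → Rise x 0 (y ∷ w)
  pick : Rise x k w → Rise x (suc k) (x ∷ w)
  skip : Rise x k w → Rise x k (y ∷ w)

-- Positions refer to the whole of `w` while the rise lives in `drop n w`, so that the positions of
-- an occurrence can be chained, each behind the previous one.
last-at : ∀ w (i : Fin (length w)) {n} → n ≤ toℕ i → x < lookup w i → Rise x 0 (drop n w)
last-at (y ∷ w) zero    {zero}  _         lt = last lt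
last-at (y ∷ w) (suc i) {zero}  _         lt = skip (last-at w i z≤n lt)
last-at (y ∷ w) (suc i) {suc n} (s≤s n≤i) lt = last-at w i n≤i lt

pick-at : ∀ w (i : Fin (length w)) {n} → n ≤ toℕ i → lookup w i ≡ x →
          Rise x k (drop (suc (toℕ i)) w) → Rise x (suc k) (drop n w)
pick-at (y ∷ w) zero    {zero}  _         refl p = pick p
pick-at (y ∷ w) (suc i) {zero}  _         eq   p = skip (pick-at w i z≤n eq p)
pick-at (y ∷ w) (suc i) {suc n} (s≤s n≤i) eq   p = pick-at w i n≤i eq p

plateau : (k x y : ℕ) → Vec ℕ (suc k)
plateau zero    x y = y ∷ []
plateau (suc k) x y = x ∷ plateau k x y

shift-positions : ∀ y (w : List ℕ) {n} (ι : Vec (Fin (length w)) n) →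
                  Vec.map (lookup (y ∷ w)) (Vec.map suc ι) ≡ Vec.map (lookup w) ι
shift-positions y w ι = sym (Vec.map-∘ (lookup (y ∷ w)) suc ι)

increasing-suc : ∀ {n m} {ι : Vec (Fin n) m} → Linked Fin._<_ ι →
                 Linked Fin._<_ (Vec.map suc ι)
increasing-suc inc = Linked.map⁺ (Linked.map s≤s inc)

rise-positions : Rise x k w →
  ∃₂ λ y (ι : Vec (Fin (length w)) (suc k)) →
     x < y × Linked Fin._<_ ι × Vec.map (lookup w) ι ≡ plateau k x y
rise-positions (last {y = y} x<y) = y , zero ∷ [] , x<y , [-] , refl
rise-positions {w = x ∷ w} (pick p) with y , i ∷ ι , x<y , inc , eq ← rise-positions p =
  y , zero ∷ suc i ∷ Vec.map suc ι , x<y ,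
  s≤s z≤n ∷ increasing-suc inc ,
  cong (x ∷_) (trans (shift-positions x w (i ∷ ι)) eq)
rise-positions {w = z ∷ w} (skip p) with y , ι , x<y , inc , eq ← rise-positions p =
  y , Vec.map suc ι , x<y , increasing-suc inc ,
  trans (shift-positions z w ι) eq

contains0001⇔ : ∀ w → Contains w (0 ∷ 0 ∷ 0 ∷ 1 ∷ []) ⇔ ∃ λ x → Rise x 3 w
contains0001⇔ w = mk⇔ rise contains
  where
  rise : Contains w (0 ∷ 0 ∷ 0 ∷ 1 ∷ []) → ∃ λ x → Rise x 3 w
  rise (i₀ ∷ i₁ ∷ i₂ ∷ i₃ ∷ [] , inc , iso) =
    lookup w i₀ ,
    pick-at w i₀ z≤n refl
      (pick-at w i₁ (inc 0F 1F (s≤s z≤n)) (same 1F 0F refl)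
        (pick-at w i₂ (inc 1F 2F (s≤s (s≤s z≤n))) (same 2F 0F refl)
          (last-at w i₃ (inc 2F 3F (s≤s (s≤s (s≤s z≤n))))
            (Equivalence.from (proj₁ (iso 0F 3F)) (s≤s z≤n)))))
    where
    same = λ j k → Equivalence.from (proj₂ (iso j k))

  contains : (∃ λ x → Rise x 3 w) → Contains w (0 ∷ 0 ∷ 0 ∷ 1 ∷ [])
  contains (x , p) with y , ι , x<y , inc , eq ← rise-positions p =
    contains-⁺ w (0 ∷ 0 ∷ 0 ∷ 1 ∷ []) ι
      (prepend-strictlyMonotone x<y (+-strictlyMonotone y)) inc λ j →
      trans (sym (Vec.lookup-map j (lookup w) ι))
        (trans (cong (λ v → Vec.lookup v j) eq) (value j))
    where
    value : ∀ j → Vec.lookup (plateau 3 x _) j ≡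
                  prepend x (ℕ._+ _) (lookup (0 ∷ 0 ∷ 0 ∷ 1 ∷ []) j)
    value 0F = refl
    value 1F = refl
    value 2F = refl
    value 3F = refl

rise-weaken : Rise x (suc k) w → Rise x k w
rise-weaken (pick p) = skip p
rise-weaken (skip p) = skip (rise-weaken p)

rise-∈ : Rise x (suc k) w → x ∈ w
rise-∈ (pick p) = here refl
rise-∈ (skip p) = there (rise-∈ p)

-- Together with `rise-uncons`: reading `x` spends one of the `k` copies. Truncation of `pred` at 0
-- is right, since with no copies to find only a letter above `x` is sought.
rise-cons : Rise x (pred k) w → Rise x k (x ∷ w)
rise-cons {k = zero}  p = skip p
rise-cons {k = suc k} p = pick p

rise-uncons : Rise x k (x ∷ w) → Rise x (pred k) w
rise-uncons             (last x<x) = contradiction x<x (ℕ.<-irrefl refl)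
rise-uncons             (pick p)   = p
rise-uncons {k = zero}  (skip p)   = p
rise-uncons {k = suc k} (skip p)   = rise-weaken p

rise-uncons-< : y < x → Rise x k (y ∷ w) → Rise x k w
rise-uncons-< y<x (last x<y) = contradiction x<y (ℕ.<-asym y<x)
rise-uncons-< y<x (pick p)   = contradiction y<x (ℕ.<-irrefl refl)
rise-uncons-< y<x (skip p)   = p

-- At index `suc k` a copy of `x` is still missing, so `y` cannot be the final letter; at index 0 it
-- would be.
rise-uncons-> : x < y → Rise x (suc k) (y ∷ w) → Rise x (suc k) w
rise-uncons-> x<y (pick p) = contradiction x<y (ℕ.<-irrefl refl)
rise-uncons-> x<y (skip p) = p

-- Prefixes of ascent sequences

ascentStep : ℕ → ℕ → ℕ
ascentStep l x = if does (l ℕ.<? x) then 1 else 0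

ascentStep-< : l < x → ascentStep l x ≡ 1
ascentStep-< {l} {x} l<x rewrite dec-true (l ℕ.<? x) l<x = refl

ascentStep-refl : ∀ x → ascentStep x x ≡ 0
ascentStep-refl x rewrite dec-false (x ℕ.<? x) (ℕ.<-irrefl refl) = refl

-- Climbs l a w: w may follow a prefix that ends in l and has a ascents.

data Climbs : ℕ → ℕ → List ℕ → Set where
  []  : Climbs l a []
  _∷_ : x ≤ suc a → Climbs x (ascentStep l x ℕ.+ a) w → Climbs l a (x ∷ w)

-- The sum is grouped so that at `l = 0` and `a = 0` it reduces to the bound in `IsAscentSequence`.
ClimbsPointwise : ℕ → ℕ → List ℕ → Set
ClimbsPointwise l a w =
  ∀ i → lookup w i ≤ a ℕ.+ (asc (List.take (suc (toℕ i)) (l ∷ w)) ℕ.+ 1)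

shift-ascents : ∀ a b c → a ℕ.+ (b ℕ.+ c ℕ.+ 1) ≡ b ℕ.+ a ℕ.+ (c ℕ.+ 1)
shift-ascents = ℕSolver.solve-∀

climbs-⁺ : ∀ w → ClimbsPointwise l a w → Climbs l a w
climbs-⁺             []      h = []
climbs-⁺ {l} {a = a} (x ∷ w) h =
  subst (x ≤_) (ℕ.+-comm a 1) (h zero) ∷
  climbs-⁺ w λ i → subst (lookup w i ≤_) (shift-ascents a (ascentStep l x) _) (h (suc i))

climbs-⁻ : ∀ w → Climbs l a w → ClimbsPointwise l a w
climbs-⁻ {a = a}     (x ∷ w) (p ∷ ps) zero    = subst (x ≤_) (ℕ.+-comm 1 a) p
climbs-⁻ {l} {a = a} (x ∷ w) (p ∷ ps) (suc i) =
  subst (lookup w i ≤_) (sym (shift-ascents a (ascentStep l x) _)) (climbs-⁻ w ps i)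

-- The suffixes u of a word whose prefix so far ends in l, has a ascents and
-- maximum m, and may be followed by fewer than r zeros (resp. s copies of m)
-- if a larger letter is still to come.

record Extends (l a m r s : ℕ) (u : List ℕ) : Set where
  constructor extends
  field
    climbs        : Climbs l a u
    sorted        : AllPairs _⊴_ (m ∷ u)
    no-zero-rise  : ¬ Rise 0 r u
    no-peak-rise  : 0 < m → ¬ Rise m s u
    no-fresh-rise : ∀ {x} → m < x → ¬ Rise x 3 u

open Extends

extends-[] : Extends l a m r s []
extends-[] = extends [] ([] ∷ []) (λ ()) (λ _ ()) (λ _ ())

⊴-0 : All (0 ⊴_) u
⊴-0 {[]}    = []
⊴-0 {x ∷ u} = inj₂ z≤n ∷ ⊴-0

below-peak : AllPairs _⊴_ (y ∷ u) → 0 < x → x < y → ¬ x ∈ u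
below-peak (y⊴u ∷ _) 0<x x<y x∈u with All.lookup y⊴u x∈u
... | inj₁ x≡0 = ℕ.m<n⇒n≢0 0<x x≡0
... | inj₂ y≤x = ℕ.<⇒≱ x<y y≤x

-- Positive letters below the maximum never recur. This is why `Extends` keeps counters only for the
-- zeros and for `m`.
no-rise-below : AllPairs _⊴_ (y ∷ u) → 0 < x → x < y → ¬ Rise x (suc k) u
no-rise-below sort 0<x x<y = below-peak sort 0<x x<y ∘ rise-∈

-- A zero lies below every positive letter, so only the zero counter changes.
fall-⁺ : Extends 0 a m (pred r) s u → Extends l a m r s (0 ∷ u)
fall-⁺ (extends c (m⊴u ∷ sort) z p f) =
  extends (z≤n ∷ c) ((inj₁ refl ∷ m⊴u) ∷ ⊴-0 ∷ sort) (z ∘ rise-uncons)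
    (λ 0<m → p 0<m ∘ rise-uncons-< 0<m)
    (λ m<x → f m<x ∘ rise-uncons-< (ℕ.m<n⇒0<n m<x))

fall-⁻ : Extends l a m r s (0 ∷ u) → Extends 0 a m (pred r) s u
fall-⁻ (extends (_ ∷ c) ((_ ∷ m⊴u) ∷ _ ∷ sort) z p f) =
  extends c (m⊴u ∷ sort) (z ∘ rise-cons) (λ 0<m → p 0<m ∘ skip) (λ m<x → f m<x ∘ skip)

-- At zero counter 0 the positive letter `m` would itself complete a rise, hence `suc r`. The peak
-- counter may be 0: that forbids larger letters, not further copies of `m`.
stay-⁺ : 0 < m → m ≤ suc a → Extends m (ascentStep l m ℕ.+ a) m (suc r) (pred s) u →
         Extends l a m (suc r) s (m ∷ u)
stay-⁺ 0<m m≤1+a (extends c (m⊴u ∷ sort) z p f) =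
  extends (m≤1+a ∷ c) ((inj₂ ℕ.≤-refl ∷ m⊴u) ∷ m⊴u ∷ sort) (z ∘ rise-uncons-> 0<m)
    (λ _ → p 0<m ∘ rise-uncons) (λ m<x → f m<x ∘ rise-uncons-< m<x)

stay-⁻ : 0 < m → Extends l a m r s (m ∷ u) →
         Extends m (ascentStep l m ℕ.+ a) m r (pred s) u
stay-⁻ 0<m (extends (_ ∷ c) (_ ∷ sort) z p f) =
  extends c sort (z ∘ skip) (λ _ → p 0<m ∘ rise-cons) (λ m<x → f m<x ∘ skip)

-- The letter `x` exceeds 0 and `m`, so both counters are taken positive. It is an ascent because
-- `l ≤ m`, and as its own first copy it starts the new peak counter at 2.
raise-⁺ : l ≤ m → m < x → x ≤ suc a → Extends x (suc a) x (suc r) 2 u →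
          Extends l a m (suc r) (suc s) (x ∷ u)
raise-⁺ {m = m} {x} {u = u} l≤m m<x x≤1+a (extends c sort@(x⊴u ∷ _) z p f) =
  extends (x≤1+a ∷ subst (λ b → Climbs x (b ℕ.+ _) u) (sym (ascentStep-< l<x)) c)
    ((inj₂ (ℕ.<⇒≤ m<x) ∷ All.map weaken x⊴u) ∷ sort)
    (z ∘ rise-uncons-> 0<x)
    (λ 0<m → no-rise-below sort 0<m m<x ∘ rise-uncons-> m<x)
    fresh′
  where
  l<x = ℕ.≤-<-trans l≤m m<x
  0<x = ℕ.m<n⇒0<n m<x

  weaken : ∀ {y} → x ⊴ y → m ⊴ y
  weaken (inj₁ y≡0) = inj₁ y≡0
  weaken (inj₂ x≤y) = inj₂ (ℕ.≤-trans (ℕ.<⇒≤ m<x) x≤y)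

  fresh′ : ∀ {y} → m < y → ¬ Rise y 3 (x ∷ u)
  -- Below `x` no copy of `y` can follow, at `x` the new peak counter applies, and above `x` the
  -- letter is still fresh.
  fresh′ {y} m<y rise with ℕ.<-cmp y x
  ... | tri< y<x _ _  = no-rise-below sort (ℕ.m<n⇒0<n m<y) y<x (rise-uncons-> y<x rise)
  ... | tri≈ _ refl _ = p 0<x (rise-uncons rise)
  ... | tri> _ _ x<y  = f x<y (rise-uncons-< x<y rise)

raise-⁻ : l ≤ m → m < x → Extends l a m r s (x ∷ u) → Extends x (suc a) x r 2 u
raise-⁻ {x = x} {u = u} l≤m m<x (extends (_ ∷ c) (_ ∷ sort) z p f) =
  extends (subst (λ b → Climbs x (b ℕ.+ _) u) (ascentStep-< (ℕ.≤-<-trans l≤m m<x)) c)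
    sort (z ∘ skip) (λ _ → f m<x ∘ rise-cons) (λ x<y → f (ℕ.<-trans m<x x<y) ∘ skip)

-- The automaton

-- zeros r is reached by a prefix of zeros, of which fewer than r more may occur
-- before a positive letter.  peak z d r s is reached by a prefix with positive
-- maximum m and m + d ascents whose last letter is 0 if z holds and m otherwise;
-- r and s are as in Extends.

data Phase : Set where
  zeros : (r : ℕ) → Phase
  peak  : (z : Bool) (d r s : ℕ) → Phase

-- Letters are recorded relative to the maximum, `raise 0` being a repetition of it, so that the
-- transitions do not depend on `m`.
data Move : Set where
  fall  : Move
  raise : ℕ → Move

letter top : Move → ℕ → ℕ
letter fall      m = 0
letter (raise k) m = k ℕ.+ m
top    fall      m = m
top    (raise k) m = k ℕ.+ m

-- The new letter `suc k + m` may be at most `suc (d + m)`, hence `k ≤ d`. There is one more ascent,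
-- so the excess over the new maximum is `d ∸ k`.
leaps : (d r s : ℕ) → List (Move × Phase)
leaps d r zero    = []
leaps d r (suc s) = map (λ k → raise (suc k) , peak false (d ∸ k) r 2) (upTo (suc d))

-- Repeating the maximum after a zero is an ascent that leaves the maximum unchanged; it is the only
-- way the excess grows.
moves : Phase → List (Move × Phase)
moves (zeros zero)        = (fall , zeros 0) ∷ []
moves (zeros (suc r))     = (fall , zeros r) ∷ (raise 1 , peak false 0 (suc r) 2) ∷ []
moves (peak z d zero s)    = (fall , peak true d 0 s) ∷ []
moves (peak z d (suc r) s) =
  (fall , peak true d r s) ∷
  (raise 0 , peak false (if z then suc d else d) (suc r) (pred s)) ∷
  leaps d (suc r) s

Valid : Phase → ℕ → Set
Valid (zeros r)      m = m ≡ 0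
Valid (peak z d r s) m = 0 < m

-- In the phase `zeros`, the `3` supplies the positive peak counter that `raise-⁺` asks for; at
-- `m = 0` the field `no-peak-rise` holds vacuously.
Suffix : Phase → ℕ → List ℕ → Set
Suffix (zeros r)      m = Extends 0 0 m r 3
Suffix (peak z d r s) m = Extends (if z then 0 else m) (d ℕ.+ m) m r s

suffix-[] : ∀ p → Suffix p m []
suffix-[] (zeros r)      = extends-[]
suffix-[] (peak z d r s) = extends-[]

last≤top : ∀ z → (if z then 0 else m) ≤ m
last≤top true  = z≤n
last≤top false = ℕ.≤-refl

stay-ascents : ∀ z → 0 < m →
  ascentStep (if z then 0 else m) m ℕ.+ (d ℕ.+ m) ≡ (if z then suc d else d) ℕ.+ m
stay-ascents         true  (s≤s _) = refl
stay-ascents {m = m} false _       rewrite ascentStep-refl m = refl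

leap-ascents : ∀ m → k ≤ d → (d ∸ k) ℕ.+ suc (k ℕ.+ m) ≡ suc (d ℕ.+ m)
leap-ascents {k} {d} m k≤d = begin
  (d ∸ k) ℕ.+ suc (k ℕ.+ m)  ≡⟨ ℕ.+-suc (d ∸ k) (k ℕ.+ m) ⟩
  suc ((d ∸ k) ℕ.+ (k ℕ.+ m)) ≡⟨ cong suc (ℕ.+-assoc (d ∸ k) k m) ⟨
  suc ((d ∸ k) ℕ.+ k ℕ.+ m)  ≡⟨ cong (λ e → suc (e ℕ.+ m)) (ℕ.m∸n+n≡m k≤d) ⟩
  suc (d ℕ.+ m)              ∎
  where open ≡-Reasoning

move-valid : ∀ p {μ q} → Valid p m → (μ , q) ∈ moves p → Valid q (top μ m)
move-valid (zeros zero)         v (here refl)         = v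
move-valid (zeros (suc r))      v (here refl)         = v
move-valid (zeros (suc r))      v (there (here refl)) = s≤s z≤n
move-valid (peak z d zero s)    v (here refl)         = v
move-valid (peak z d (suc r) s) v (here refl)         = v
move-valid (peak z d (suc r) s) v (there (here refl)) = v
move-valid (peak z d (suc r) (suc s)) v (there (there i))
  with k , _ , refl ← ∈-map⁻ _ i = s≤s z≤n

move-⁺ : ∀ p {μ q} → Valid p m → (μ , q) ∈ moves p →
         Suffix q (top μ m) u → Suffix p m (letter μ m ∷ u)
move-⁺ (zeros zero)    refl (here refl)         e = fall-⁺ e
move-⁺ (zeros (suc r)) refl (here refl)         e = fall-⁺ e
move-⁺ (zeros (suc r)) refl (there (here refl)) e =
  raise-⁺ z≤n (s≤s z≤n) (s≤s z≤n) e
move-⁺ (peak z d zero s)    v (here refl) e = fall-⁺ e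
move-⁺ (peak z d (suc r) s) v (here refl) e = fall-⁺ e
move-⁺ {m} {u} (peak z d (suc r) s) v (there (here refl)) e =
  stay-⁺ v (ℕ.m≤n⇒m≤1+n (ℕ.m≤n+m m d))
    (subst (λ a → Extends m a m (suc r) (pred s) u) (sym (stay-ascents z v)) e)
move-⁺ {m} {u} (peak z d (suc r) (suc s)) v (there (there i)) e
  with k , k∈ , refl ← ∈-map⁻ _ i =
  raise-⁺ (last≤top z) (s≤s (ℕ.m≤n+m m k)) (s≤s (ℕ.+-monoˡ-≤ m k≤d))
    (subst (λ a → Extends (suc k ℕ.+ m) a (suc k ℕ.+ m) (suc r) 2 u)
           (leap-ascents m k≤d) e)
  where k≤d = ℕ.≤-pred (∈-upTo⁻ k∈)

Continues : Phase → ℕ → ℕ → List ℕ → Set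
Continues p m x u = ∃₂ λ μ q → (μ , q) ∈ moves p × x ≡ letter μ m × Suffix q (top μ m) u

fall-∈ : ∀ p → ∃ λ q → (fall , q) ∈ moves p ×
         (∀ {u} → Suffix p m (0 ∷ u) → Suffix q m u)
fall-∈ (zeros zero)         = _ , here refl , fall-⁻
fall-∈ (zeros (suc r))      = _ , here refl , fall-⁻
fall-∈ (peak z d zero s)    = _ , here refl , fall-⁻
fall-∈ (peak z d (suc r) s) = _ , here refl , fall-⁻

-- A positive letter is compared with `m`: below `m` it contradicts sortedness, above `m` at peak
-- counter 0 it completes a rise, and otherwise the climbing bound limits the jump.
move-⁻ : ∀ p → Valid p m → Suffix p m (x ∷ u) → Continues p m x u
move-⁻ {x = zero} p v e with q , q∈ , f ← fall-∈ p = fall , q , q∈ , refl , f e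
move-⁻ {x = suc x} (zeros zero) refl e =
  contradiction (last (s≤s z≤n)) (no-zero-rise e)
-- Without ascents so far, the bound forces the first positive letter to be 1.
move-⁻ {x = suc x} (zeros (suc r)) refl e@(extends (s≤s z≤n ∷ _) _ _ _ _) =
  raise 1 , _ , there (here refl) , refl , raise-⁻ z≤n (s≤s z≤n) e
move-⁻ {x = suc x} (peak z d zero s) v e =
  contradiction (last (s≤s z≤n)) (no-zero-rise e)
move-⁻ {m} {suc x} {u} (peak z d (suc r) s) v e with ℕ.<-cmp m (suc x)
... | tri≈ _ refl _ =
  raise 0 , _ , there (here refl) , refl ,
  subst (λ a → Extends m a m (suc r) (pred s) u) (stay-ascents z v) (stay-⁻ v e)
... | tri> _ _ x<m with () ← below-peak (sorted e) (s≤s z≤n) x<m (here refl)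
move-⁻ {m} {suc x} {u} (peak z d (suc r) zero) v e | tri< m<x _ _ =
  contradiction (last m<x) (no-peak-rise e v)
move-⁻ {m} {suc x} {u} (peak z d (suc r) (suc s)) v e@(extends (x≤a ∷ _) _ _ _ _)
  | tri< (s≤s m≤x) _ _ =
  raise (suc j) , _ , there (there (∈-map⁺ _ (∈-upTo⁺ (s≤s j≤d)))) , x≡j+m ,
  subst (λ y → Extends y (d ∸ j ℕ.+ y) y (suc r) 2 u) x≡j+m
    (subst (λ a → Extends (suc x) a (suc x) (suc r) 2 u)
      (sym (trans (cong (d ∸ j ℕ.+_) x≡j+m) (leap-ascents m j≤d)))
      (raise-⁻ (last≤top z) (s≤s m≤x) e))
  where
  -- The difference is exact because `m ≤ x`; the letter `suc x` is `suc j + m`.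
  j = x ∸ m

  x≡j+m : suc x ≡ suc (j ℕ.+ m)
  x≡j+m = cong suc (sym (ℕ.m∸n+n≡m m≤x))

  j≤d : j ≤ d
  j≤d = ℕ.m≤n+o⇒m∸n≤o _ m (subst (x ≤_) (ℕ.+-comm d m) (ℕ.≤-pred x≤a))

-- Makes the automaton deterministic: a word determines its path, so paths can be counted instead of
-- words. Validity separates the letter 0 from a repeated maximum.
letters-unique : ∀ p → Valid p m → Unique (map (λ (μ , _) → letter μ m) (moves p))
letters-unique (zeros zero)         v    = [] ∷ []
letters-unique (zeros (suc r))      refl = ((λ ()) ∷ []) ∷ [] ∷ []
letters-unique (peak z d zero s)    v    = [] ∷ []
letters-unique {m} (peak z d (suc r) s) v =
  (ℕ.<⇒≢ v ∷ All.map ℕ.<⇒≢ (All.map (ℕ.<-trans v) (above s))) ∷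
  All.map ℕ.<⇒≢ (above s) ∷ leaps-unique s
  where
  leap-letters : List ℕ → List ℕ
  leap-letters = map (λ k → suc k ℕ.+ m)

  leap-letters-≡ : ∀ s → map (λ (μ , _) → letter μ m) (leaps d (suc r) (suc s)) ≡
                   leap-letters (upTo (suc d))
  leap-letters-≡ s = sym (map-∘ (upTo (suc d)))

  above : ∀ s → All (m <_) (map (λ (μ , _) → letter μ m) (leaps d (suc r) s))
  above zero    = []
  above (suc s) = subst (All (m <_)) (sym (leap-letters-≡ s))
    (All.map⁺ (All.tabulate λ {k} _ → s≤s (ℕ.m≤n+m m k)))

  leaps-unique : ∀ s → Unique (map (λ (μ , _) → letter μ m) (leaps d (suc r) s))
  leaps-unique zero    = []
  leaps-unique (suc s) = subst Unique (sym (leap-letters-≡ s))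
    (Unique.map⁺ (ℕ.+-cancelʳ-≡ m _ _ ∘ ℕ.suc-injective) (Unique.upTo⁺ (suc d)))

-- Enumeration of the paths

completions : ℕ → Phase → ℕ → List (List ℕ)
completions zero    p m = [] ∷ []
completions (suc n) p m =
  concatMap (λ (μ , q) → map (letter μ m ∷_) (completions n q (top μ m))) (moves p)

-- The maximum has disappeared: the number of completions depends on the phase alone, which leaves a
-- finite linear system.
count : ℕ → Phase → ℕ
count zero    p = 1
count (suc n) p = sum (map (count n ∘ proj₂) (moves p))

length-concatMap : ∀ {A B : Set} (f : A → List B) xs →
                   length (concatMap f xs) ≡ sum (map (length ∘ f) xs)
length-concatMap f []       = refl
length-concatMap f (x ∷ xs) =
  trans (length-++ (f x)) (cong (length (f x) ℕ.+_) (length-concatMap f xs))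

length-completions : ∀ n p m → length (completions n p m) ≡ count n p
length-completions zero    p m = refl
length-completions (suc n) p m = trans (length-concatMap _ (moves p))
  (cong sum (map-cong (λ (μ , q) → trans (length-map _ (completions n q (top μ m)))
                                         (length-completions n q (top μ m))) (moves p)))

completions-unique : ∀ n p → Valid p m → Unique (completions n p m)
completions-unique         zero    p v = [] ∷ []
completions-unique {m = m} (suc n) p v =
  Unique.concat⁺
    (All.map⁺ (All.tabulate λ {(μ , q)} i →
      Unique.map⁺ ∷-injectiveʳ (completions-unique n q (move-valid p v i))))
    (AllPairs.map⁺ (AllPairs.map disjoint (AllPairs.map⁻ (letters-unique p v))))
  where
  disjoint : ∀ {x y} {us ws : List (List ℕ)} → x ≢ y →
             Disjoint (map (x ∷_) us) (map (y ∷_) ws)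
  disjoint x≢y (i , j) with _ , _ , refl ← ∈-map⁻ _ i | _ , _ , eq ← ∈-map⁻ _ j =
    x≢y (∷-injectiveˡ eq)

∈-completions⁺ : ∀ u p → Valid p m → Suffix p m u → u ∈ completions (length u) p m
∈-completions⁺ []      p v e = here refl
∈-completions⁺ (x ∷ u) p v e with μ , q , q∈ , refl , e′ ← move-⁻ p v e =
  ∈-concatMap⁺ _ (lose q∈ (∈-map⁺ _ (∈-completions⁺ u q (move-valid p v q∈) e′)))

∈-completions⁻ : ∀ n p → Valid p m → u ∈ completions n p m → length u ≡ n × Suffix p m u
∈-completions⁻ zero    p v (here refl) = refl , suffix-[] p
∈-completions⁻ (suc n) p v u∈
  with (μ , q) , q∈ , u∈′ ← find (∈-concatMap⁻ _ {xs = moves p} u∈)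
  with u′ , u′∈ , refl ← ∈-map⁻ _ u∈′
  with refl , e ← ∈-completions⁻ n q (move-valid p v q∈) u′∈ =
  refl , move-⁺ p v q∈ e

-- Counting

pattern0001 : List ℕ
pattern0001 = 0 ∷ 0 ∷ 0 ∷ 1 ∷ []

-- Two duplicate-free lists with the same members are permutations of each other. The first letter
-- is forced to be 0, and `zeros 2` is the phase after reading it.
b-count : ∀ n → b pattern0001 (suc n) ≡ count n (zeros 2)
b-count n = begin
  length (B pattern0001 (suc n))
    ≡⟨ ↭-length (∼bag⇒↭ (unique∧set⇒bag (B-unique pattern0001 (suc n)) unique same)) ⟩
  length (map (0 ∷_) suffixes)
    ≡⟨ length-map _ suffixes ⟩
  length suffixes
    ≡⟨ length-completions n (zeros 2) 0 ⟩
  count n (zeros 2)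
    ∎
  where
  open ≡-Reasoning

  suffixes : List (List ℕ)
  suffixes = completions n (zeros 2) 0

  unique : Unique (map (0 ∷_) suffixes)
  unique = Unique.map⁺ ∷-injectiveʳ (completions-unique n (zeros 2) refl)

  to : ∀ {w} → InB pattern0001 (suc n) w → w ∈ map (0 ∷_) suffixes
  to {x ∷ u} (refl , (refl , ascents) , avoids021 , avoids0001) =
    ∈-map⁺ _ (∈-completions⁺ u (zeros 2) refl (extends
      (climbs-⁺ u ascents)
      (⊴-0 ∷ Equivalence.to (avoids021⇔ u) avoids021)
      (λ rise → avoids0001 (Equivalence.from (contains0001⇔ (0 ∷ u)) (0 , pick rise)))
      (λ ())
      (λ _ rise → avoids0001 (Equivalence.from (contains0001⇔ (0 ∷ u)) (_ , skip rise)))))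

  from : ∀ {w} → w ∈ map (0 ∷_) suffixes → InB pattern0001 (suc n) w
  from w∈ with u , u∈ , refl ← ∈-map⁻ _ w∈
          with refl , extends climb (_ ∷ sort) no-zero _ no-fresh ←
                 ∈-completions⁻ n (zeros 2) refl u∈ =
    refl , (refl , climbs-⁻ u climb) , Equivalence.from (avoids021⇔ u) sort , avoids
    where
    avoids : Avoids (0 ∷ u) pattern0001
    avoids c with Equivalence.to (contains0001⇔ (0 ∷ u)) c
    ... | zero  , rise = no-zero (rise-uncons rise)
    ... | suc x , rise = no-fresh (s≤s z≤n) (rise-uncons-< (s≤s z≤n) rise)

  same : ∀ {w} → w ∈ B pattern0001 (suc n) ⇔ w ∈ map (0 ∷_) suffixes
  same {w} = mk⇔ (to ∘ Equivalence.to (∈-B pattern0001 (suc n) w))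
                 (Equivalence.from (∈-B pattern0001 (suc n) w) ∘ from)

-- Power series

infixr 5 _⊕_

⟦_⟧ : List ℤ → Series
⟦ [] ⟧    n       = 0ℤ
⟦ c ∷ p ⟧ zero    = c
⟦ c ∷ p ⟧ (suc n) = ⟦ p ⟧ n

_⊕_ _⊗_ : List ℤ → List ℤ → List ℤ
[]      ⊕ q       = q
(c ∷ p) ⊕ []      = c ∷ p
(c ∷ p) ⊕ (e ∷ q) = c ℤ.+ e ∷ p ⊕ q
[]      ⊗ q       = []
(c ∷ p) ⊗ q       = map (c ℤ.*_) q ⊕ (0ℤ ∷ p ⊗ q)

⊕-correct : ∀ p q n → ⟦ p ⊕ q ⟧ n ≡ ⟦ p ⟧ n ℤ.+ ⟦ q ⟧ n
⊕-correct []      q       n       = sym (ℤ.+-identityˡ _)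
⊕-correct (c ∷ p) []      n       = sym (ℤ.+-identityʳ _)
⊕-correct (c ∷ p) (e ∷ q) zero    = refl
⊕-correct (c ∷ p) (e ∷ q) (suc n) = ⊕-correct p q n

scale-correct : ∀ c q n → ⟦ map (c ℤ.*_) q ⟧ n ≡ c ℤ.* ⟦ q ⟧ n
scale-correct c []      n       = sym (ℤ.*-zeroʳ c)
scale-correct c (e ∷ q) zero    = refl
scale-correct c (e ∷ q) (suc n) = scale-correct c q n

-- By definition, the product at `suc n` unfolds to `p 0` times `q (suc n)` plus the product of
-- `p ∘ suc` and `q` at `n`; inductions on products follow this unfolding.
*-cong : ∀ {p p′ q q′} → p ≗ p′ → q ≗ q′ → p * q ≗ p′ * q′
*-cong p≗ q≗ zero    = cong (ℤ._+ 0ℤ) (cong₂ ℤ._*_ (p≗ 0) (q≗ 0))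
*-cong p≗ q≗ (suc n) =
  cong₂ ℤ._+_ (cong₂ ℤ._*_ (p≗ 0) (q≗ (suc n))) (*-cong (p≗ ∘ suc) q≗ n)

*-zeroˡ : ∀ q → (λ _ → 0ℤ) * q ≗ λ _ → 0ℤ
*-zeroˡ q zero    = refl
*-zeroˡ q (suc n) = cong (λ v → 0ℤ ℤ.+ v) (*-zeroˡ q n)

*-zeroʳ : ∀ p → p * (λ _ → 0ℤ) ≗ λ _ → 0ℤ
*-zeroʳ p zero    = trans (ℤ.+-identityʳ _) (ℤ.*-zeroʳ (p 0))
*-zeroʳ p (suc n) = cong₂ ℤ._+_ (ℤ.*-zeroʳ (p 0)) (*-zeroʳ (p ∘ suc) n)

*-distribˡ-+ : ∀ p g h → p * (g + h) ≗ p * g + p * h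
*-distribˡ-+ p g h zero    = lemma (p 0) (g 0) (h 0)
  where
  lemma : ∀ a b c → a ℤ.* (b ℤ.+ c) ℤ.+ 0ℤ ≡ (a ℤ.* b ℤ.+ 0ℤ) ℤ.+ (a ℤ.* c ℤ.+ 0ℤ)
  lemma = solve-∀
*-distribˡ-+ p g h (suc n) =
  trans (cong (λ v → p 0 ℤ.* (g (suc n) ℤ.+ h (suc n)) ℤ.+ v) (*-distribˡ-+ (p ∘ suc) g h n))
        (lemma (p 0) (g (suc n)) (h (suc n)) _ _)
  where
  lemma : ∀ a b c u v →
    a ℤ.* (b ℤ.+ c) ℤ.+ (u ℤ.+ v) ≡ (a ℤ.* b ℤ.+ u) ℤ.+ (a ℤ.* c ℤ.+ v)
  lemma = solve-∀

-- Splits off the last term of the convolution instead of the first, so that the shift falls on `g`,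
-- where the recursion of `count` acts.
*-suc : ∀ p g n → (p * g) (suc n) ≡ (p * (g ∘ suc)) n ℤ.+ p (suc n) ℤ.* g 0
*-suc p g zero    = lemma (p 0 ℤ.* g 1) (p 1 ℤ.* g 0)
  where
  lemma : ∀ a b → a ℤ.+ (b ℤ.+ 0ℤ) ≡ (a ℤ.+ 0ℤ) ℤ.+ b
  lemma = solve-∀
*-suc p g (suc n) = trans (cong (λ v → p 0 ℤ.* g (suc (suc n)) ℤ.+ v) (*-suc (p ∘ suc) g n))
  (sym (ℤ.+-assoc (p 0 ℤ.* g (suc (suc n))) _ _))

⊗-correct : ∀ p q → ⟦ p ⟧ * ⟦ q ⟧ ≗ ⟦ p ⊗ q ⟧
⊗-correct []      q n = *-zeroˡ ⟦ q ⟧ n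
⊗-correct (c ∷ p) q n = trans (lemma n) (sym (trans (⊕-correct (map (c ℤ.*_) q) _ n)
  (cong (ℤ._+ ⟦ 0ℤ ∷ p ⊗ q ⟧ n) (scale-correct c q n))))
  where
  lemma : ∀ n → (⟦ c ∷ p ⟧ * ⟦ q ⟧) n ≡ c ℤ.* ⟦ q ⟧ n ℤ.+ ⟦ 0ℤ ∷ p ⊗ q ⟧ n
  lemma zero    = refl
  lemma (suc n) = cong (λ v → c ℤ.* ⟦ q ⟧ (suc n) ℤ.+ v) (⊗-correct p q n)

-- A record rather than the bare equation, so that `c` and `p` can be inferred from the type.
record _Represents_ (c : List ℤ) (p : Series) : Set where
  constructor represents
  field coefficients : p ≗ ⟦ c ⟧

open _Represents_

private
  variable
    c e : List ℤ
    p q : Series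

𝟙-represented : (1ℤ ∷ []) Represents 𝟙
𝟙-represented = represents λ { zero → refl ; (suc n) → refl }

X-represented : (0ℤ ∷ 1ℤ ∷ []) Represents X
X-represented = represents λ { zero → refl ; (suc zero) → refl ; (suc (suc n)) → refl }

+-represented : c Represents p → e Represents q → (c ⊕ e) Represents (p + q)
+-represented {c} {e = e} (represents h) (represents k) = represents λ n →
  trans (cong₂ ℤ._+_ (h n) (k n)) (sym (⊕-correct c e n))

-‿represented : c Represents p → e Represents q →
                (c ⊕ map (-1ℤ ℤ.*_) e) Represents (p - q)
-‿represented {c} {e = e} (represents h) (represents k) = represents λ n →
  trans (cong₂ ℤ._-_ (h n) (k n))
    (sym (trans (⊕-correct c _ n) (cong (λ v → ⟦ c ⟧ n ℤ.+ v)
      (trans (scale-correct -1ℤ e n) (ℤ.-1*i≡-i (⟦ e ⟧ n))))))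

*-represented : c Represents p → e Represents q → (c ⊗ e) Represents (p * q)
*-represented {c} {e = e} (represents h) (represents k) = represents λ n →
  trans (*-cong h k n) (⊗-correct c e n)

·-represented : ∀ k → c Represents p → map (+ k ℤ.*_) c Represents (k · p)
·-represented {c} k (represents h) = represents λ n →
  trans (cong (+ k ℤ.*_) (h n)) (sym (scale-correct (+ k) c n))

power : List ℤ → ℕ → List ℤ
power c zero    = 1ℤ ∷ []
power c (suc k) = c ⊗ power c k

^-represented : ∀ k → c Represents p → power c k Represents (p ^ k)
^-represented zero    h = 𝟙-represented
^-represented (suc k) h = *-represented h (^-represented k h)

-- One step of long division replaces `p` by a remainder, which is the product of `q` and `g ∘ suc`
-- because `g 0` equals `p 0`.
quotient-unique : ∀ p q g {q₀≡1 : True (q 0 ℤ.≟ 1ℤ)} →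
                  q * g ≗ p → g ≗ _/_ p q {q₀≡1}
quotient-unique p q g {q₀≡1} q*g≗p zero = begin
  g 0                 ≡⟨ ℤ.*-identityˡ (g 0) ⟨
  1ℤ ℤ.* g 0          ≡⟨ cong (ℤ._* g 0) (toWitness q₀≡1) ⟨
  q 0 ℤ.* g 0         ≡⟨ ℤ.+-identityʳ _ ⟨
  q 0 ℤ.* g 0 ℤ.+ 0ℤ  ≡⟨ q*g≗p 0 ⟩
  p 0                 ∎
  where open ≡-Reasoning
quotient-unique p q g {q₀≡1} q*g≗p (suc n) =
  quotient-unique (λ k → p (suc k) ℤ.- p 0 ℤ.* q (suc k)) q (g ∘ suc) {q₀≡1} shifted n
  where
  open ≡-Reasoning

  lemma : ∀ a b c → a ≡ (a ℤ.+ b ℤ.* c) ℤ.- c ℤ.* b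
  lemma = solve-∀

  shifted : ∀ k → (q * (g ∘ suc)) k ≡ p (suc k) ℤ.- p 0 ℤ.* q (suc k)
  shifted k = begin
    (q * (g ∘ suc)) k
      ≡⟨ lemma _ (q (suc k)) (g 0) ⟩
    ((q * (g ∘ suc)) k ℤ.+ q (suc k) ℤ.* g 0) ℤ.- g 0 ℤ.* q (suc k)
      ≡⟨ cong₂ (λ s t → s ℤ.- t ℤ.* q (suc k)) (sym (*-suc q g k))
               (quotient-unique p q g {q₀≡1} q*g≗p 0) ⟩
    (q * g) (suc k) ℤ.- p 0 ℤ.* q (suc k)
      ≡⟨ cong (ℤ._- (p 0 ℤ.* q (suc k))) (q*g≗p (suc k)) ⟩
    p (suc k) ℤ.- p 0 ℤ.* q (suc k)
      ∎

-- The generating functions of the phases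

numerator denominator : Series
numerator   = 𝟙 - 5 · X + 8 · X ^ 2 - 10 · X ^ 4 + 5 · X ^ 5 + X ^ 6 + X ^ 8
denominator = (𝟙 - X) ^ 3 * (𝟙 - X - X ^ 2) ^ 3

numerator-coefficients denominator-coefficients : List ℤ
numerator-coefficients =
  + 1 ∷ ℤ.- + 5 ∷ + 8 ∷ + 0 ∷ ℤ.- + 10 ∷ + 5 ∷ + 1 ∷ + 0 ∷ + 1 ∷ []
denominator-coefficients =
  + 1 ∷ ℤ.- + 6 ∷ + 12 ∷ ℤ.- + 5 ∷ ℤ.- + 12 ∷ + 12 ∷ + 3 ∷ ℤ.- + 6 ∷ + 0 ∷ + 1 ∷ []

-- The combinators follow the syntax of the series; evaluation identifies the list they compute with
-- the displayed one.
numerator-represented : numerator-coefficients Represents numerator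
numerator-represented =
  +-represented (+-represented (+-represented (-‿represented (+-represented
    (-‿represented 𝟙-represented (·-represented 5 X-represented))
    (·-represented 8 (^-represented 2 X-represented)))
    (·-represented 10 (^-represented 4 X-represented)))
    (·-represented 5 (^-represented 5 X-represented)))
    (^-represented 6 X-represented))
    (^-represented 8 X-represented)

denominator-represented : denominator-coefficients Represents denominator
denominator-represented = *-represented
  (^-represented 3 (-‿represented 𝟙-represented X-represented))
  (^-represented 3 (-‿represented (-‿represented 𝟙-represented X-represented)
                                  (^-represented 2 X-represented)))

countSeries : Phase → Series
countSeries p n = + count n p

_≟ᴾ_ : DecidableEquality Phase
zeros r      ≟ᴾ zeros r′          = map′ (cong zeros) (λ { refl → refl }) (r ℕ.≟ r′)
zeros _      ≟ᴾ peak _ _ _ _      = no λ ()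
peak _ _ _ _ ≟ᴾ zeros _           = no λ ()
peak z d r s ≟ᴾ peak z′ d′ r′ s′  =
  map′ (λ { (refl , refl , refl , refl) → refl }) (λ { refl → refl , refl , refl , refl })
       ((z Bool.≟ z′) ×-dec (d ℕ.≟ d′) ×-dec (r ℕ.≟ r′) ×-dec (s ℕ.≟ s′))

open import Data.List.Membership.DecPropositional _≟ᴾ_ using (_∈?_)

-- The excess stays at most 1: it grows only when a zero is followed by a copy of the maximum, peaks
-- start with zero counter at most 2, and at counter 0 no positive letter follows.
reachable : List Phase
reachable = map zeros (upTo 3) ++ concatMap
  (λ s → peak false 0 2 s ∷ peak false 0 1 s ∷ peak true 0 1 s ∷
         peak false 1 1 s ∷ peak true 0 0 s ∷ peak true 1 0 s ∷ [])
  (upTo 3)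

reachable-closed : All (λ p → All (_∈ reachable) (map proj₂ (moves p))) reachable
reachable-closed =
  toWitness {a? = All.all? (λ p → All.all? (_∈? reachable) (map proj₂ (moves p))) reachable} tt

-- The denominator has degree 9, so from index 10 on the boundary term of `*-suc` vanishes; index 9
-- is where the induction can start.
vanishing-base : All (λ p → (⟦ denominator-coefficients ⟧ * countSeries p) 9 ≡ 0ℤ) reachable
vanishing-base = toWitness
  {a? = All.all? (λ p → (⟦ denominator-coefficients ⟧ * countSeries p) 9 ℤ.≟ 0ℤ) reachable} tt

sumSeries : List Phase → Series
sumSeries ps n = + sum (map (count n) ps)

vanishing-sum : ∀ g n ps → All (λ p → (g * countSeries p) n ≡ 0ℤ) ps →
                (g * sumSeries ps) n ≡ 0ℤ
vanishing-sum g n []       []       = *-zeroʳ g n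
vanishing-sum g n (p ∷ ps) (h ∷ hs) = begin
  (g * sumSeries (p ∷ ps)) n
    ≡⟨ *-cong {g} (λ _ → refl) (λ k → ℤ.pos-+ (count k p) (sum (map (count k) ps))) n ⟩
  (g * (countSeries p + sumSeries ps)) n
    ≡⟨ *-distribˡ-+ g (countSeries p) (sumSeries ps) n ⟩
  (g * countSeries p) n ℤ.+ (g * sumSeries ps) n
    ≡⟨ cong₂ ℤ._+_ h (vanishing-sum g n ps hs) ⟩
  0ℤ
    ∎
  where open ≡-Reasoning

-- Shifting the index replaces a phase by the sum of its successors, so one
-- vanishing coefficient for all phases forces all later ones to vanish.

vanishing : ∀ k {p} → p ∈ reachable →
            (⟦ denominator-coefficients ⟧ * countSeries p) (9 ℕ.+ k) ≡ 0ℤ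
vanishing zero    p∈ = All.lookup vanishing-base p∈
vanishing (suc k) {p} p∈ = begin
  (Q * countSeries p) (10 ℕ.+ k)
    ≡⟨ *-suc Q (countSeries p) (9 ℕ.+ k) ⟩
  (Q * (countSeries p ∘ suc)) (9 ℕ.+ k) ℤ.+ 0ℤ
    ≡⟨ ℤ.+-identityʳ _ ⟩
  (Q * (countSeries p ∘ suc)) (9 ℕ.+ k)
    ≡⟨ *-cong {Q} (λ _ → refl)
         (λ n → cong (+_ ∘ sum) (map-∘ {g = count n} {f = proj₂} (moves p))) (9 ℕ.+ k) ⟩
  (Q * sumSeries (map proj₂ (moves p))) (9 ℕ.+ k)
    ≡⟨ vanishing-sum Q (9 ℕ.+ k) _
         (All.map (vanishing k) (All.lookup reachable-closed p∈)) ⟩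
  0ℤ
    ∎
  where
  open ≡-Reasoning
  Q : Series
  Q = ⟦ denominator-coefficients ⟧

avoiderCount : ℕ → ℕ
avoiderCount zero    = 1
avoiderCount (suc n) = count n (zeros 2)

f≗avoiderCount : f pattern0001 ≗ +_ ∘ avoiderCount
f≗avoiderCount zero    = refl
f≗avoiderCount (suc n) = cong +_ (b-count n)

-- The counting series is 1 plus x times that of `zeros 2`, so coefficient `10 + k` of the product
-- is coefficient `9 + k` for `zeros 2`. The smaller indices are evaluated.
avoiderCount-product :
  ⟦ denominator-coefficients ⟧ * (+_ ∘ avoiderCount) ≗ ⟦ numerator-coefficients ⟧
avoiderCount-product 0 = refl
avoiderCount-product 1 = refl
avoiderCount-product 2 = refl
avoiderCount-product 3 = refl
avoiderCount-product 4 = refl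
avoiderCount-product 5 = refl
avoiderCount-product 6 = refl
avoiderCount-product 7 = refl
avoiderCount-product 8 = refl
avoiderCount-product 9 = refl
avoiderCount-product (suc (suc (suc (suc (suc (suc (suc (suc (suc (suc k)))))))))) =
  trans (*-suc ⟦ denominator-coefficients ⟧ (+_ ∘ avoiderCount) (9 ℕ.+ k))
    (trans (ℤ.+-identityʳ _) (vanishing k (there (there (here refl)))))

theorem3p2 : f (0 ∷ 0 ∷ 0 ∷ 1 ∷ [])
    ≗ (𝟙 - 5 · X + 8 · X ^ 2 - 10 · X ^ 4 + 5 · X ^ 5 + X ^ 6 + X ^ 8)
    / ((𝟙 - X) ^ 3 * (𝟙 - X - X ^ 2) ^ 3)
theorem3p2 = quotient-unique numerator denominator (f pattern0001) λ n → begin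
  (denominator * f pattern0001) n
    ≡⟨ *-cong (coefficients denominator-represented) f≗avoiderCount n ⟩
  (⟦ denominator-coefficients ⟧ * (+_ ∘ avoiderCount)) n
    ≡⟨ avoiderCount-product n ⟩
  ⟦ numerator-coefficients ⟧ n
    ≡⟨ coefficients numerator-represented n ⟨
  numerator n
    ∎
  where open ≡-Reasoning
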